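{- There exist a declared regime $\tau$, a fixed finite record domain $R$, histories $H\preceq H^{\ast}$ over $R$, and an audit surface $d$ over $R$ such that $d$ is faithful to $\tau$ on $(R,H)$ (i.e. with $\sim_\tau$ computed from $H$), while a divergence witness for $(d,\tau)$ exists on $(R,H^{\ast})$ (i.e. with $\sim_\tau$ computed from $H^{\ast}$). Here the record domain, the registry, the surface (its mechanism and its identified uses), the records of the witness, and their identity treatment $\mathsf{IT}_d$ are the same for $H$ and $H^{\ast}$.
   Context: Regimes and declared identity. $\mathcal{F}$ is a finite set of transformation families. An identity regime $\rho$ carries a classification function $\mathrm{Class}_\rho:\mathcal{F}\to\{\mathsf{PRS},\mathsf{BRK},\mathsf{NEU},\mathsf{N/A}\}$; a family $f$ is non-breaking under $\rho$ if $\mathrm{Class}_\rho(f)\in\{\mathsf{PRS},\mathsf{NEU}\}$. The families, regimes and classifications come from a fixed finite interface in which regimes with non-breaking families exist; for example, for the carrier kind of rules, the content-fixed regime RULE-C classifies the families refine-structure and revise-wording as $\mathsf{PRS}$. A history over $R$ is a finite sequence $H=\langle(f_i,x_i,y_i)\rangle_{i=1}^n$ with $f_i\in\mathcal{F}$ and $x_i,y_i\in R$; the empty sequence is allowed. $H\preceq H^{\ast}$ means $H$ is a subsequence of $H^{\ast}$. Put $E_\rho=\{(x_i,y_i)\mid \mathrm{Class}_\rho(f_i)\in\{\mathsf{PRS},\mathsf{NEU}\}\}$; $\sim_\rho$ is the equivalence relation on $R$ generated by $E_\rho$. Surfaces. A mechanism registry $D_B$ is a finite set of artifacts $d$, each with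 a total computable map $d:R\to V_d$. For nonempty finite $S\subseteq D_B$ the joint mechanism is $d_S(r)=\langle d(r)\mid d\in S\rangle$; $\mathcal{D}_B$ is the set of joint mechanisms. An audit surface over $R$ is a mechanism $d\in\mathcal{D}_B$ with a finite sequence $U_d=\langle u_1,\dots,u_m\rangle$ of computable identity-relevant uses $u_j:R\to O_j$ (outcome functions of designated types such as referent-identifier assignment), each of the form $u_j=\tilde u_j\circ d$ on $R$ for some $\tilde u_j:V_d\to O_j$. Registry and surface may be chosen freely. $\mathsf{IT}_d(r)=\langle u_1(r),\dots,u_m(r)\rangle$; $r\approx_d s$ iff $\mathsf{IT}_d(r)=\mathsf{IT}_d(s)$. Faithfulness. $d$ is faithful to $\tau$ when $r\sim_\tau s\Rightarrow r\approx_d s$ for all $r,s\in R$. A divergence witness for $(d,\tau)$ is a pair $(r,s)\in R\times R$ with $r\sim_\tau s$ and $\mathsf{IT}_d(r)\ne\mathsf{IT}_d(s)$. -}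

module Defs where

open import Data.Fin using (Fin)
open import Data.List using (List; [])
open import Data.List.Membership.Propositional using (_∈_)
open import Data.List.Relation.Unary.All as All using (All)
open import Data.List.Relation.Unary.Unique.Propositional using (Unique)
open import Data.List.Relation.Binary.Sublist.Propositional using (_⊆_)
open import Data.Nat using (ℕ)
open import Data.Product using (Σ-syntax; ∃-syntax; _×_; _,_)
open import Data.Sum using (_⊎_)
open import Function.Bundles using (_↔_; _↣_)
open import Relation.Binary.Construct.Closure.Equivalence using (EqClosure)
open import Relation.Binary.PropositionalEquality using (_≡_; _≢_)

record FiniteSet : Set₁ where
  field
    Carrier : Set
    size    : ℕ
    finite  : Carrier ↔ Fin size

open FiniteSet public using (Carrier)

-- Computable maps need codomains with effective names for their values, so
-- these come with an injective coding into ℕ.  A map from a finite set into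
-- such a codomain is a finite table of numbers, hence computable; no further
-- computability condition is therefore imposed on maps out of a record domain.
record CodedSet : Set₁ where
  field
    Value : Set
    code  : Value ↣ ℕ

open CodedSet public using (Value)

data Classification : Set where
  PRS BRK NEU N/A : Classification

-- The interface is a parameter of the development: of its concrete tables,
-- only that some regime has a non-breaking family is assumed.
record Interface : Set₁ where
  field
    families : FiniteSet
    regimes  : FiniteSet
    Class    : Carrier regimes → Carrier families → Classification

  NonBreaking : Carrier regimes → Carrier families → Set
  NonBreaking ρ f = Class ρ f ≡ PRS ⊎ Class ρ f ≡ NEU

  field
    nonBreakingExists : ∃[ ρ ] ∃[ f ] NonBreaking ρ f

    -- The designated types of identity-relevant uses.  They label uses; the
    -- outcome set is chosen separately for each use.
    UseType                      : Set
    referentIdentifierAssignment : UseType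

  Family Regime : Set
  Family = Carrier families
  Regime = Carrier regimes

module Audit (I : Interface) (R : FiniteSet) where
  open Interface I

  Record : Set
  Record = Carrier R

  History : Set
  History = List (Family × Record × Record)

  _⪯_ : History → History → Set
  H ⪯ H* = H ⊆ H*   -- order-preserving sublist, not mere inclusion of elements

  E : Regime → History → Record → Record → Set
  E ρ H x y = ∃[ f ] ((f , x , y) ∈ H × NonBreaking ρ f)

  Identified : Regime → History → Record → Record → Set
  Identified ρ H = EqClosure (E ρ H)

  record Artifact : Set₁ where
    field
      V     : CodedSet
      apply : Record → Value V

  record Registry : Set₁ where
    field
      artifacts : List Artifact
      unique    : Unique artifacts

  -- Sublists of a duplicate-free list are exactly the subsets of the set it
  -- lists, each occurring once.
  record JointMechanism (D : Registry) : Set₁ where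
    field
      S        : List Artifact
      S⊆D      : S ⊆ Registry.artifacts D
      nonempty : S ≢ []

    -- All P xs serves here, and for IT below, as the type of heterogeneous
    -- tuples with one component in P x for each x in xs.
    JointValue : Set₁
    JointValue = All (λ d → Value (Artifact.V d)) S

    joint : Record → JointValue
    joint r = All.universal (λ d → Artifact.apply d r) S

  record Use : Set₁ where
    field
      useType : UseType
      O       : CodedSet
      outcome : Record → Value O

  FactorsThrough : ∀ {D} → JointMechanism D → Use → Set₁
  FactorsThrough d u =
    Σ[ ũ ∈ (JointValue → Value O) ] (∀ r → outcome r ≡ ũ (joint r))
    where
    open JointMechanism d
    open Use u

  record Surface (D : Registry) : Set₁ where
    field
      mechanism : JointMechanism D
      uses      : List Use
      factors   : All (FactorsThrough mechanism) uses

    IT : Record → All (λ u → Value (Use.O u)) uses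
    IT r = All.universal (λ u → Use.outcome u r) uses

    _≈_ : Record → Record → Set₁
    r ≈ s = IT r ≡ IT s

  Faithful : ∀ {D} → Surface D → Regime → History → Set₁
  Faithful d τ H = ∀ r s → Identified τ H r s → r ≈ s
    where open Surface d

  DivergenceWitness : ∀ {D} → Surface D → Regime → History → Set₁
  DivergenceWitness d τ H =
    Σ[ (r , s) ∈ Record × Record ] (Identified τ H r s × IT r ≢ IT s)
    where open Surface d

{-# OPTIONS --safe #-}
-- A regime identifies nothing over the empty history, so any surface is faithful
-- to it there; a single non-breaking event between two records that the surface
-- tells apart then produces a divergence witness.
module Submission where

open import Data.Fin using (Fin; zero; suc; toℕ)
open import Data.Fin.Properties using (toℕ-injective; 0≢1+n)
open import Data.List using ([]; [_])
open import Data.List.Relation.Binary.Sublist.Propositional using (⊆-refl; minimum)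
open import Data.List.Relation.Unary.All as All using ([]; _∷_)
open import Data.List.Relation.Unary.AllPairs using ([]; _∷_)
open import Data.List.Relation.Unary.Any using (here)
open import Data.Nat using (ℕ)
open import Data.Product using (Σ-syntax; _×_; _,_)
open import Function using (_∘_; id)
open import Function.Bundles using (mk↣)
open import Function.Construct.Identity using (↔-id)
open import Relation.Binary.Construct.Closure.Equivalence using (return)
open import Relation.Binary.Construct.Closure.ReflexiveTransitive using (ε; _◅_)
open import Relation.Binary.Construct.Closure.Symmetric using (fwd; bwd)
open import Relation.Binary.PropositionalEquality using (_≡_; refl; cong)
open import Defs

finFiniteSet : ℕ → FiniteSet
finFiniteSet n = record { Carrier = Fin n ; size = n ; finite = ↔-id (Fin n) }

finCodedSet : ℕ → CodedSet
finCodedSet n = record { Value = Fin n ; code = mk↣ {to = toℕ} toℕ-injective }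

module _ (I : Interface) where
  open Interface I

  module _ {R : FiniteSet} where
    open Audit I R

    -- A first step of the closure path, forward or backward, would carry a membership proof in
    -- `[]`; only the trivial path `ε` remains.
    identified-[]⇒≡ : ∀ {τ r s} → Identified τ [] r s → r ≡ s
    identified-[]⇒≡ ε                    = refl
    identified-[]⇒≡ (fwd (_ , () , _) ◅ _)
    identified-[]⇒≡ (bwd (_ , () , _) ◅ _)

    faithful-[] : ∀ {D} (d : Surface D) τ → Faithful d τ []
    faithful-[] d τ r s = cong (Surface.IT d) ∘ identified-[]⇒≡

  module _ (n : ℕ) where
    open Audit I (finFiniteSet n)

    -- The identity loses no information, so any use of the records could factor through it.
    idArtifact : Artifact
    idArtifact = record { V = finCodedSet n ; apply = id }

    idRegistry : Registry
    idRegistry = record { artifacts = [ idArtifact ] ; unique = [] ∷ [] }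

    idMechanism : JointMechanism idRegistry
    idMechanism = record
      { S        = [ idArtifact ]
      ; S⊆D      = ⊆-refl
      ; nonempty = λ ()
      }

    -- Each record serves as its own referent identifier, so this one use makes `IT` injective.
    idUse : Use
    idUse = record
      { useType = referentIdentifierAssignment
      ; O       = finCodedSet n
      ; outcome = id
      }

    idSurface : Surface idRegistry
    idSurface = record
      { mechanism = idMechanism
      ; uses      = [ idUse ]
      -- A joint value here is a one-component tuple holding the record, so `All.head` recovers the
      -- outcome.
      ; factors   = (All.head , λ _ → refl) ∷ []
      }

proposition5p5 : (I : Interface) →
    Σ[ τ ∈ Interface.Regime I ]
    Σ[ R ∈ FiniteSet ]
    Σ[ H ∈ Audit.History I R ]
    Σ[ H* ∈ Audit.History I R ]
    Σ[ D ∈ Audit.Registry I R ]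
    Σ[ d ∈ Audit.Surface I R D ]
    ( Audit._⪯_ I R H H*
    × Audit.Faithful I R d τ H
    × Audit.DivergenceWitness I R d τ H* )
proposition5p5 I =
  let τ , f , nonBreaking = Interface.nonBreakingExists I
      -- One event of the non-breaking family `f` supplied by the interface links the two records of
      -- `Fin 2`.
      H* = [ (f , zero , suc zero) ]
  in τ , finFiniteSet 2 , [] , H* , idRegistry I 2 , idSurface I 2
   , minimum H*
   , faithful-[] I (idSurface I 2) τ
   , (zero , suc zero)
   , return (f , here refl , nonBreaking)
   -- Equal treatments would have equal first outcomes, that is `zero ≡ suc zero`.
   , 0≢1+n ∘ cong All.head
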